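{- For every finite simple graph $G$ there exist infinitely many pairwise non-isomorphic finite simple graphs $G^*$ such that $X(G^*)\cong G$, where $X(\cdot)$ denotes the mincut graph operator.
   Context: All graphs are finite and simple (not necessarily connected unless stated). For a connected graph $H$, an edge-cut of $H$ is a subset $S\subseteq E(H)$ such that $H-S$ is disconnected; a mincut of $H$ is an edge-cut of minimum cardinality, and this cardinality is the edge-connectivity $\lambda(H)$. The mincut graph $X(H)$ of $H$ is the intersection graph of the mincuts: it has one vertex for each mincut of $H$, and two distinct vertices are adjacent if and only if the corresponding mincuts have non-empty intersection (as sets of edges). If $H$ is disconnected (or has no edge-cut), $X(H)$ is the null graph $K_0$, with no vertices and no edges. -}

module Defs where

open import Data.Bool.Base using (true; false)
open import Data.Fin.Base using (Fin; toℕ)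
open import Data.Fin.Properties as Fin using (any?; all?; toℕ<n; toℕ-injective)
open import Data.Fin.Subset using (Subset; inside; outside; _∈_; _∩_; ∣_∣; Nonempty)
open import Data.Fin.Subset.Properties using (_∈?_; anySubset?; nonempty?; ∩-comm)
open import Data.List.Base using (List; []; _∷_; _++_; map; filter; length; lookup; allFin; cartesianProduct)
open import Data.List.Membership.Propositional using () renaming (_∈_ to _∈ˡ_)
open import Data.List.Membership.Propositional.Properties using (∈-map⁺; ∈-map⁻; ∈-++⁺ˡ; ∈-++⁺ʳ)
open import Data.List.Relation.Unary.All using ([])
open import Data.List.Relation.Unary.Any using (here)
open import Data.List.Relation.Unary.AllPairs using ([]; _∷_)
open import Data.List.Relation.Unary.Unique.Propositional using (Unique)
import Data.List.Relation.Unary.Unique.Propositional.Properties as Unique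
open import Data.Nat.Base using (ℕ; zero; suc; _≤_; _<_; s≤s)
open import Data.Nat.Properties as ℕ using (_≤?_; m≤n⇒m<n∨m≡n)
open import Data.Product.Base using (_×_; _,_; ∃-syntax; proj₂)
open import Data.Product.Properties using (≡-dec)
open import Data.Sum.Base using (_⊎_; inj₁; inj₂; swap)
import Data.Vec.Base as Vec
open import Data.Vec.Properties using (∷-injectiveʳ)
open import Function.Base using (_∘_)
open import Function.Bundles using (_↔_; _⇔_; Inverse)
open import Level using (0ℓ)
open import Relation.Binary.Core using (Rel)
open import Relation.Binary.Construct.Closure.ReflexiveTransitive using (Star; ε; _◅_; _◅◅_)
open import Relation.Binary.Definitions using (Decidable; Symmetric)
open import Relation.Binary.PropositionalEquality using (_≡_; _≢_; refl; sym; trans; subst; ≢-sym)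
open import Relation.Nullary using (¬_; Dec; yes; no)
open import Relation.Nullary.Decidable using (map′; ¬?; _×-dec_; _⊎-dec_; _→-dec_; decidable-stable)
open import Relation.Unary as Unary using (Pred)

record Graph : Set₁ where
  field
    order   : ℕ
    Adj     : Rel (Fin order) 0ℓ
    adj?    : Decidable Adj
    adj-sym : Symmetric Adj
    loopless : ∀ v → ¬ Adj v v

open Graph public

infix 4 _≅_

record _≅_ (G H : Graph) : Set where
  field
    bijection : Fin (order G) ↔ Fin (order H)
    adjacency : ∀ u v → Adj G u v ⇔ Adj H (Inverse.to bijection u) (Inverse.to bijection v)

-- The graph without vertices counts as connected here.  This is immaterial
-- below, because it has no edge-cut under either convention.
Connected : Graph → Set
Connected H = ∀ u v → Star (Adj H) u v

-- Each edge {u , v} is listed exactly once, as the pair (u , v) with u < v.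
edges : (H : Graph) → List (Fin (order H) × Fin (order H))
edges H = filter (λ (u , v) → (u Fin.<? v) ×-dec adj? H u v)
                 (cartesianProduct (allFin (order H)) (allFin (order H)))

Edge : Graph → Set
Edge H = Fin (length (edges H))

EdgeSet : Graph → Set
EdgeSet H = Subset (length (edges H))

Joins : (H : Graph) → Edge H → Fin (order H) → Fin (order H) → Set
Joins H e u v = lookup (edges H) e ≡ (u , v) ⊎ lookup (edges H) e ≡ (v , u)

joins? : (H : Graph) (e : Edge H) → Decidable (Joins H e)
joins? H e u v = (lookup (edges H) e ≟ (u , v)) ⊎-dec (lookup (edges H) e ≟ (v , u))
  where _≟_ = ≡-dec Fin._≟_ Fin._≟_

infixl 6 _─_

_─_ : (H : Graph) → EdgeSet H → Graph
H ─ S = record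
  { order    = order H
  ; Adj      = λ u v → Adj H u v × ¬ (∃[ e ] e ∈ S × Joins H e u v)
  ; adj?     = λ u v → adj? H u v ×-dec ¬? (any? λ e → (e ∈? S) ×-dec joins? H e u v)
  ; adj-sym  = λ (uv , ∉S) → adj-sym H uv , λ (e , e∈S , j) → ∉S (e , e∈S , swap j)
  ; loopless = λ v (vv , _) → loopless H v vv
  }

IsEdgeCut : (H : Graph) → EdgeSet H → Set
IsEdgeCut H S = Connected H × ¬ Connected (H ─ S)

IsMincut : (H : Graph) → EdgeSet H → Set
IsMincut H S = IsEdgeCut H S × (∀ T → IsEdgeCut H T → ∣ S ∣ ≤ ∣ T ∣)

-- Warshall's algorithm: Via k u v says that v is reachable from u through
-- intermediate vertices whose index is below k.
module Reachability {n} {R : Rel (Fin n) 0ℓ} (R? : Decidable R) where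

  Via : ℕ → Rel (Fin n) 0ℓ
  Via zero    u v = u ≡ v ⊎ R u v
  Via (suc k) u v = Via k u v ⊎ (∃[ w ] toℕ w ≡ k × Via k u w × Via k w v)

  via? : ∀ k → Decidable (Via k)
  via? zero    u v = (u Fin.≟ v) ⊎-dec R? u v
  via? (suc k) u v = via? k u v ⊎-dec
    any? (λ w → (toℕ w ℕ.≟ k) ×-dec via? k u w ×-dec via? k w v)

  via⇒star : ∀ k {u v} → Via k u v → Star R u v
  via⇒star zero    (inj₁ refl)              = ε
  via⇒star zero    (inj₂ r)                 = r ◅ ε
  via⇒star (suc k) (inj₁ p)                 = via⇒star k p
  via⇒star (suc k) (inj₂ (_ , _ , p , q))   = via⇒star k p ◅◅ via⇒star k q

  weaken : ∀ k {u v} → Via 0 u v → Via k u v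
  weaken zero    p = p
  weaken (suc k) p = inj₁ (weaken k p)

  compose : ∀ k {u w v} → toℕ w < k → Via k u w → Via k w v → Via k u v
  compose (suc k) {u} {w} {v} (s≤s w≤k) p q with m≤n⇒m<n∨m≡n w≤k
  ... | inj₂ w≡k = inj₂ (w , w≡k , into p , outof q)
    where
    into : ∀ {x} → Via (suc k) x w → Via k x w
    into (inj₁ r) = r
    into (inj₂ (x , x≡k , r , _)) =
      subst (Via k _) (toℕ-injective (trans x≡k (sym w≡k))) r
    outof : ∀ {x} → Via (suc k) w x → Via k w x
    outof (inj₁ r) = r
    outof (inj₂ (x , x≡k , _ , r)) =
      subst (λ y → Via k y _) (toℕ-injective (trans x≡k (sym w≡k))) r
  compose (suc k) w≤k (inj₁ p) (inj₁ q) | inj₁ w<k = inj₁ (compose k w<k p q)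
  compose (suc k) w≤k (inj₁ p) (inj₂ (x , x≡k , q , r)) | inj₁ w<k =
    inj₂ (x , x≡k , compose k w<k p q , r)
  compose (suc k) w≤k (inj₂ (x , x≡k , p , q)) (inj₁ r) | inj₁ w<k =
    inj₂ (x , x≡k , p , compose k w<k q r)
  compose (suc k) w≤k (inj₂ (x , x≡k , p , _)) (inj₂ (y , y≡k , _ , r)) | inj₁ w<k =
    inj₂ (x , x≡k , p , subst (λ z → Via k z _) (toℕ-injective (trans y≡k (sym x≡k))) r)

  star⇒via : ∀ {u v} → Star R u v → Via n u v
  star⇒via ε        = weaken n (inj₁ refl)
  star⇒via (r ◅ rs) = compose n (toℕ<n _) (weaken n (inj₂ r)) (star⇒via rs)

  star? : Decidable (Star R)
  star? u v = map′ (via⇒star n) star⇒via (via? n u v)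

connected? : Unary.Decidable Connected
connected? H = all? λ u → all? λ v → Reachability.star? (adj? H) u v

allSubset? : ∀ {n} {P : Pred (Subset n) 0ℓ} → Unary.Decidable P → Dec (∀ S → P S)
allSubset? P? with anySubset? (¬? ∘ P?)
... | yes (S , ¬p) = no λ p → ¬p (p S)
... | no ∄         = yes λ S → decidable-stable (P? S) λ ¬p → ∄ (S , ¬p)

isEdgeCut? : (H : Graph) → Unary.Decidable (IsEdgeCut H)
isEdgeCut? H S = connected? H ×-dec ¬? (connected? (H ─ S))

isMincut? : (H : Graph) → Unary.Decidable (IsMincut H)
isMincut? H S = isEdgeCut? H S ×-dec
  allSubset? (λ T → isEdgeCut? H T →-dec (∣ S ∣ ≤? ∣ T ∣))

subsets : ∀ n → List (Subset n)
subsets zero    = Vec.[] ∷ []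
subsets (suc n) = map (inside Vec.∷_) (subsets n) ++ map (outside Vec.∷_) (subsets n)

∈-subsets : ∀ {n} (S : Subset n) → S ∈ˡ subsets n
∈-subsets Vec.[]            = here refl
∈-subsets (true Vec.∷ S)    = ∈-++⁺ˡ (∈-map⁺ _ (∈-subsets S))
∈-subsets {suc n} (false Vec.∷ S) =
  ∈-++⁺ʳ (map (inside Vec.∷_) (subsets n)) (∈-map⁺ _ (∈-subsets S))

subsets-unique : ∀ n → Unique (subsets n)
subsets-unique zero    = [] ∷ []
subsets-unique (suc n) = Unique.++⁺
  (Unique.map⁺ ∷-injectiveʳ (subsets-unique n))
  (Unique.map⁺ ∷-injectiveʳ (subsets-unique n))
  λ (p , q) → disjoint (proj₂ (proj₂ (∈-map⁻ _ p))) (proj₂ (proj₂ (∈-map⁻ _ q)))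
  where
  disjoint : ∀ {S : Subset (suc n)} {T U} → S ≡ inside Vec.∷ T → ¬ (S ≡ outside Vec.∷ U)
  disjoint refl ()

-- Each mincut occurs exactly once, by ∈-subsets and subsets-unique.
mincuts : (H : Graph) → List (EdgeSet H)
mincuts H = filter (isMincut? H) (subsets (length (edges H)))

X : Graph → Graph
X H = record
  { order    = length (mincuts H)
  ; Adj      = λ i j → i ≢ j × Nonempty (cut i ∩ cut j)
  ; adj?     = λ i j → ¬? (i Fin.≟ j) ×-dec nonempty? (cut i ∩ cut j)
  ; adj-sym  = λ {i} {j} (i≢j , ne) → ≢-sym i≢j , subst Nonempty (∩-comm (cut i) (cut j)) ne
  ; loopless = λ i (i≢i , _) → i≢i refl
  }
  where
  cut : Fin (length (mincuts H)) → EdgeSet H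
  cut = lookup (mincuts H)

{-# OPTIONS --safe #-}
module Submission where

-- Let n > 0 be the order of G (if n = 0, take edgeless graphs).  Add to G a large clique containing
-- a hub and a copy of each vertex of G, and join a vertex v of G to the hub and to the copies of
-- exactly those vertices that are not adjacent to v (v itself included).  Every vertex of G then
-- has degree n + 1, and the stars of two of them share an edge iff the vertices are adjacent in G.
-- These stars are the only mincuts: colour the vertices by connectivity in the complement of an
-- edge-cut, so that every bichromatic edge belongs to the cut.  Splitting the clique costs more
-- than n + 1 edges.  Otherwise some v in G is not coloured like the hub; then v – hub is in the
-- cut, and so is, for every w in G, the edge from v to w or its copy if w is coloured like the hub,
-- and the edge from w to its copy if it is not.  These are n + 1 edges, and any further vertex v′
-- not coloured like the hub adds v′ – hub.

open import Defs
open import Data.Bool.Base using (Bool)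
import Data.Bool.Properties as Bool
open import Data.Empty using (⊥; ⊥-elim)
open import Data.Fin.Base using (Fin; zero; suc; _<_; _↑ˡ_; join; splitAt; punchIn)
open import Data.Fin.Permutation using (↔⇒≡)
open import Data.Fin.Properties as Fin
  using (any?; suc-injective; ↑ˡ-injective; injective⇒≤; splitAt-join; join-splitAt;
         punchIn-injective; punchInᵢ≢i; ¬∀⟶∃¬; <-cmp; <-asym)
open import Data.Fin.Subset using (Subset; inside; outside; _∈_; _⊆_; _∩_; ∣_∣; Nonempty)
open import Data.Fin.Subset.Properties using (_∈?_; ⊆-antisym; p⊂q⇒∣p∣<∣q∣; x∈p∩q⁺; x∈p∩q⁻)
open import Data.List.Base using (List; []; _∷_; lookup; allFin; cartesianProduct)
open import Data.List.Membership.Propositional using () renaming (_∈_ to _∈ˡ_)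
open import Data.List.Membership.Propositional.Properties
  using (∈-lookup; ∈-filter⁺; ∈-filter⁻; ∈-cartesianProduct⁺; ∈-allFin)
import Data.List.Relation.Unary.All as All
open import Data.List.Relation.Unary.AllPairs using (_∷_)
open import Data.List.Relation.Unary.Any using (index)
open import Data.List.Relation.Unary.Any.Properties using (lookup-index)
open import Data.List.Relation.Unary.Unique.Propositional using (Unique)
import Data.List.Relation.Unary.Unique.Propositional.Properties as Unique
open import Data.Nat.Base using (ℕ; zero; suc; _+_; _≤_)
open import Data.Nat.Properties as ℕ using (≤-trans; <⇒≱; n≤1+n; m≤m+n)
open import Data.Product.Base using (_×_; Σ-syntax; ∃-syntax; _,_; proj₁; proj₂)
open import Data.Product.Properties using (,-injectiveˡ; ,-injectiveʳ)
open import Data.Sum.Base using (_⊎_; inj₁; inj₂; swap)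
open import Data.Sum.Properties using (inj₁-injective; inj₂-injective)
import Data.Vec.Base as Vec
open import Data.Vec.Properties using (lookup∘tabulate; []=⇒lookup; lookup⇒[]=)
open import Function.Base using (_∘_; id)
open import Function.Bundles using (_⇔_; mk⇔; mk↔ₛ′; Equivalence)
open import Function.Definitions using (Injective)
open import Relation.Binary.Construct.Closure.ReflexiveTransitive as Star using (Star; ε; _◅_; _◅◅_)
open import Relation.Binary.Definitions using (tri<; tri≈; tri>)
open import Relation.Binary.PropositionalEquality
  using (_≡_; _≢_; refl; sym; trans; cong; cong₂; subst; subst₂; ≢-sym)
open import Relation.Nullary using (¬_; Dec; yes; no; does; contradiction)
open import Relation.Nullary.Decidable
  using (_⊎-dec_; _×-dec_; ¬?; decidable-stable; dec-true; dec-false; does-⇔)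
open import Relation.Unary using (Decidable)

-- Repetition-free lists and cardinalities of subsets

lookup-injective : ∀ {A : Set} {xs : List A} → Unique xs → Injective _≡_ _≡_ (lookup xs)
lookup-injective (_   ∷ _)  {zero}  {zero}  _  = refl
lookup-injective (x∉  ∷ _)  {zero}  {suc j} eq = contradiction eq (All.lookup x∉ (∈-lookup j))
lookup-injective (x∉  ∷ _)  {suc i} {zero}  eq = contradiction (sym eq) (All.lookup x∉ (∈-lookup i))
lookup-injective (_   ∷ xs) {suc i} {suc j} eq = cong suc (lookup-injective xs eq)

-- The position of `x` among the elements of `p`. Together with `element`, which goes the other way,
-- it reduces bounds on `∣ p ∣` to injections between finite types.
rank : ∀ {n} {p : Subset n} {x} → x ∈ p → Fin ∣ p ∣
rank {p = inside  Vec.∷ p} Vec.here      = zero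
rank {p = inside  Vec.∷ p} (Vec.there i) = suc (rank i)
rank {p = outside Vec.∷ p} (Vec.there i) = rank i

rank-injective : ∀ {n} {p : Subset n} {x y} (x∈p : x ∈ p) (y∈p : y ∈ p) →
                 rank x∈p ≡ rank y∈p → x ≡ y
rank-injective {p = inside  Vec.∷ p} Vec.here      Vec.here      _  = refl
rank-injective {p = inside  Vec.∷ p} (Vec.there i) (Vec.there j) eq =
  cong suc (rank-injective i j (suc-injective eq))
rank-injective {p = outside Vec.∷ p} (Vec.there i) (Vec.there j) eq =
  cong suc (rank-injective i j eq)

element : ∀ {n} (p : Subset n) → Fin ∣ p ∣ → Fin n
element (inside  Vec.∷ p) zero    = zero
element (inside  Vec.∷ p) (suc i) = suc (element p i)
element (outside Vec.∷ p) i       = suc (element p i)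

element-∈ : ∀ {n} (p : Subset n) i → element p i ∈ p
element-∈ (inside  Vec.∷ p) zero    = Vec.here
element-∈ (inside  Vec.∷ p) (suc i) = Vec.there (element-∈ p i)
element-∈ (outside Vec.∷ p) i       = Vec.there (element-∈ p i)

element-injective : ∀ {n} (p : Subset n) → Injective _≡_ _≡_ (element p)
element-injective (inside  Vec.∷ p) {zero}  {zero}  _  = refl
element-injective (inside  Vec.∷ p) {suc i} {suc j} eq =
  cong suc (element-injective p (suc-injective eq))
element-injective (outside Vec.∷ p) eq = element-injective p (suc-injective eq)

injective-into⇒≤∣p∣ : ∀ {m n} {p : Subset n} (f : Fin m → Fin n) → Injective _≡_ _≡_ f →
                      (∀ i → f i ∈ p) → m ≤ ∣ p ∣
injective-into⇒≤∣p∣ f f-inj f∈p = injective⇒≤ {f = rank ∘ f∈p} λ {i} {j} →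
  f-inj ∘ rank-injective (f∈p i) (f∈p j)

covered⇒∣p∣≤ : ∀ {m n} {p : Subset n} (f : Fin m → Fin n) →
               (∀ {x} → x ∈ p → ∃[ i ] f i ≡ x) → ∣ p ∣ ≤ m
covered⇒∣p∣≤ {p = p} f cover = injective⇒≤ {f = proj₁ ∘ preimage} λ {i} {j} eq →
  element-injective p
    (trans (sym (proj₂ (preimage i))) (trans (cong f eq) (proj₂ (preimage j))))
  where
  preimage : ∀ i → ∃[ j ] f j ≡ element p i
  preimage i = cover (element-∈ p i)

⊆∧∣∣≤⇒≡ : ∀ {n} {p q : Subset n} → p ⊆ q → ∣ q ∣ ≤ ∣ p ∣ → p ≡ q
⊆∧∣∣≤⇒≡ {p = p} {q} p⊆q q≤p = ⊆-antisym p⊆q q⊆p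
  where
  q⊆p : q ⊆ p
  q⊆p {x} x∈q = decidable-stable (x ∈? p) λ x∉p →
    <⇒≱ (p⊂q⇒∣p∣<∣q∣ (p⊆q , x , x∈q , x∉p)) q≤p

-- Edges, stars and separating colourings of a graph

module _ (H : Graph) where

  private
    V = Fin (order H)

    proper? : Decidable {A = V × V} (λ (u , v) → u < v × Adj H u v)
    proper? (u , v) = (u Fin.<? v) ×-dec adj? H u v

    proper : ∀ e → let (u , v) = lookup (edges H) e in u < v × Adj H u v
    proper e = proj₂ (∈-filter⁻ proper? {xs = cartesianProduct (allFin _) (allFin _)} (∈-lookup e))

    listed : ∀ {u v} → u < v → Adj H u v → ∃[ e ] lookup (edges H) e ≡ (u , v)
    listed u<v uv = index p , sym (lookup-index p)
      where p = ∈-filter⁺ proper? (∈-cartesianProduct⁺ (∈-allFin _) (∈-allFin _)) (u<v , uv)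

    edge-injective : Injective _≡_ _≡_ (lookup (edges H))
    edge-injective = lookup-injective
      (Unique.filter⁺ proper? (Unique.cartesianProduct⁺ (Unique.allFin⁺ _) (Unique.allFin⁺ _)))

  edge-joining : ∀ {u v} → Adj H u v → ∃[ e ] Joins H e u v
  edge-joining {u} {v} uv with <-cmp u v
  ... | tri< u<v _ _  = let e , eq = listed u<v uv in e , inj₁ eq
  ... | tri≈ _ refl _ = contradiction uv (loopless H u)
  ... | tri> _ _ v<u  = let e , eq = listed v<u (adj-sym H uv) in e , inj₂ eq

  joins⇒adj : ∀ {e u v} → Joins H e u v → Adj H u v
  joins⇒adj {e} (inj₁ eq) = subst (λ (u , v) → Adj H u v) eq (proj₂ (proper e))
  joins⇒adj {e} (inj₂ eq) = adj-sym H (subst (λ (u , v) → Adj H u v) eq (proj₂ (proper e)))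

  joins-unique : ∀ {e f u v} → Joins H e u v → Joins H f u v → e ≡ f
  joins-unique         (inj₁ p) (inj₁ q) = edge-injective (trans p (sym q))
  joins-unique         (inj₂ p) (inj₂ q) = edge-injective (trans p (sym q))
  -- Listed edges have their smaller end first, so the mixed cases give `u < v` as well as `v < u`.
  joins-unique {e} {f} (inj₁ p) (inj₂ q) = ⊥-elim (<-asym
    (subst (λ (u , v) → u < v) p (proj₁ (proper e)))
    (subst (λ (u , v) → u < v) q (proj₁ (proper f))))
  joins-unique {e} {f} (inj₂ p) (inj₁ q) = ⊥-elim (<-asym
    (subst (λ (u , v) → u < v) p (proj₁ (proper e)))
    (subst (λ (u , v) → u < v) q (proj₁ (proper f))))

  joins-ends : ∀ {e u v x y} → Joins H e u v → Joins H e x y →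
               (u , v) ≡ (x , y) ⊎ (u , v) ≡ (y , x)
  joins-ends (inj₁ p) (inj₁ q) = inj₁ (trans (sym p) q)
  joins-ends (inj₁ p) (inj₂ q) = inj₂ (trans (sym p) q)
  joins-ends (inj₂ p) (inj₁ q) with refl ← trans (sym p) q = inj₂ refl
  joins-ends (inj₂ p) (inj₂ q) with refl ← trans (sym p) q = inj₁ refl

  star : V → EdgeSet H
  star v = Vec.tabulate λ e → does (any? (joins? H e v))

  ∈-star⁺ : ∀ {e v x} → Joins H e v x → e ∈ star v
  ∈-star⁺ {e} {v} {x} j = lookup⇒[]= e (star v)
    (trans (lookup∘tabulate _ e) (dec-true (any? (joins? H e v)) (x , j)))

  ∈-star⁻ : ∀ {e v} → e ∈ star v → ∃[ x ] Joins H e v x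
  ∈-star⁻ {e} {v} e∈ with any? (joins? H e v) | trans (sym (lookup∘tabulate _ e)) ([]=⇒lookup e∈)
  ... | yes x | _  = x
  ... | no _  | ()

  star-∩⁺ : ∀ {u v} → Adj H u v → Nonempty (star u ∩ star v)
  star-∩⁺ uv = let e , j = edge-joining uv in e , x∈p∩q⁺ (∈-star⁺ j , ∈-star⁺ (swap j))

  -- A common edge has both `u` and `v` as ends, and these are distinct, so it joins them.
  star-∩⁻ : ∀ {u v} → u ≢ v → Nonempty (star u ∩ star v) → Adj H u v
  star-∩⁻ {u} {v} u≢v (e , e∈) with x∈p∩q⁻ (star u) (star v) e∈
  ... | e∈u , e∈v with ∈-star⁻ e∈u | ∈-star⁻ e∈v
  ... | x , ux | y , vy with joins-ends ux vy
  ... | inj₁ refl = contradiction refl u≢v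
  ... | inj₂ refl = joins⇒adj ux

  -- Without its star, `v` is isolated: the first step of a path from `v` to `x` would be an edge of
  -- the star.
  star-disconnects : ∀ {v x} → v ≢ x → ¬ Connected (H ─ star v)
  star-disconnects {v} {x} v≢x conn with conn v x
  ... | ε = v≢x refl
  ... | (vy , ∉star) ◅ _ = let e , j = edge-joining vy in ∉star (e , ∈-star⁺ j , j)

  -- A positive certificate that `S` disconnects: lower bounds on `∣ S ∣` are read off from the
  -- edges between the two colour classes.
  SeparatingColouring : EdgeSet H → Set
  SeparatingColouring S = Σ[ colour ∈ (V → Bool) ]
    (∃[ x ] ∃[ y ] colour x ≢ colour y) ×
    (∀ {x y} → Adj H x y → colour x ≢ colour y → ∃[ e ] e ∈ S × Joins H e x y)

  -- The decision procedure is a variable here because unfolding Warshall's algorithm is slow.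
  colouring-by-reachability : ∀ {S} → (∀ x y → Dec (Star (Adj (H ─ S)) x y)) →
    ¬ Connected (H ─ S) → SeparatingColouring S
  colouring-by-reachability {S} reach? disconnected
    with ¬∀⟶∃¬ _ _ (λ x → Fin.all? (reach? x)) disconnected
  ... | u , ¬reach-all with ¬∀⟶∃¬ _ _ (reach? u) ¬reach-all
  ... | v , ¬reach-v = colour , (u , v , u≢v) , bichromatic
    where
    -- The class of `u` consists of the vertices that `u` reaches in `H ─ S`; `v` lies outside it.
    colour : V → Bool
    colour x = does (reach? u x)
    u≢v : colour u ≢ colour v
    u≢v eq with () ← trans (sym (dec-true (reach? u u) ε))
                       (trans eq (dec-false (reach? u v) ¬reach-v))
    bichromatic : ∀ {x y} → Adj H x y → colour x ≢ colour y → ∃[ e ] e ∈ S × Joins H e x y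
    bichromatic {x} {y} xy x≢y with any? (λ e → (e ∈? S) ×-dec joins? H e x y)
    ... | yes found = found
    -- An edge outside `S` can be walked in both directions, so `u` reaches both of its ends or
    -- neither.
    ... | no ∉S = contradiction
      (does-⇔ (mk⇔ (_◅◅ ((xy , ∉S) ◅ ε)) (_◅◅ (yx ◅ ε))) (reach? u x) (reach? u y)) x≢y
      where
      yx : Adj (H ─ S) y x
      yx = adj-sym (H ─ S) (xy , ∉S)

  opaque
    -- Opaque, so that later proofs cannot unfold the reachability test inside the colouring either.
    separating-colouring : ∀ {S} → ¬ Connected (H ─ S) → SeparatingColouring S
    separating-colouring {S} = colouring-by-reachability (Reachability.star? (adj? (H ─ S)))

  -- Orienting all pairs from the vertices not coloured b to those coloured b prevents two pairs
  -- from being reversals of each other, so that distinct pairs give distinct edges.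
  crossing⇒≤∣S∣ : ∀ {S m} ((colour , _) : SeparatingColouring S) (b : Bool) →
    (pair : Fin m → V × V) → Injective _≡_ _≡_ pair →
    (∀ i → let (x , y) = pair i in Adj H x y × colour x ≢ b × colour y ≡ b) → m ≤ ∣ S ∣
  crossing⇒≤∣S∣ (colour , _ , bichromatic) b pair pair-inj crosses =
    injective-into⇒≤∣p∣ edge inj (proj₁ ∘ proj₂ ∘ crossing)
    where
    crossing : ∀ i → let (x , y) = pair i in ∃[ e ] e ∈ _ × Joins H e x y
    crossing i = let xy , x≢b , y≡b = crosses i in
      bichromatic xy λ x≡y → x≢b (trans x≡y y≡b)
    edge : Fin _ → Edge H
    edge = proj₁ ∘ crossing
    inj : Injective _≡_ _≡_ edge
    inj {i} {j} eq
      with joins-ends (proj₂ (proj₂ (crossing i)))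
             (subst (λ e → Joins H e _ _) (sym eq) (proj₂ (proj₂ (crossing j))))
    ... | inj₁ p = pair-inj p
    ... | inj₂ p = ⊥-elim (proj₁ (proj₂ (crosses i))
                     (trans (cong colour (,-injectiveˡ p)) (proj₂ (proj₂ (crosses j)))))

-- Recovering the mincut graph from a classification of the mincuts

module _ (H G : Graph) (cut : Fin (order G) → EdgeSet H) (cut-injective : Injective _≡_ _≡_ cut)
  (cut-mincut : ∀ v → IsMincut H (cut v)) (mincut-cut : ∀ {S} → IsMincut H S → ∃[ v ] cut v ≡ S)
  (meets : ∀ u v → Adj G u v ⇔ (u ≢ v × Nonempty (cut u ∩ cut v))) where

  -- `mincuts H` lists every mincut exactly once, so its positions correspond to the vertices of `G`
  -- through `cut`. Adjacency is transported along the resulting equalities of cuts.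
  mincuts-classified⇒X≅ : X H ≅ G
  mincuts-classified⇒X≅ = record
    { bijection = mk↔ₛ′ to from to∘from from∘to
    ; adjacency = λ i j → mk⇔
        (λ (i≢j , ne) → Equivalence.from (meets (to i) (to j))
          ( (λ eq → i≢j (trans (sym (from∘to i)) (trans (cong from eq) (from∘to j))))
          , subst₂ (λ S T → Nonempty (S ∩ T)) (sym (cut∘to i)) (sym (cut∘to j)) ne))
        (λ ij → let to≢ , ne = Equivalence.to (meets (to i) (to j)) ij in
          to≢ ∘ cong to , subst₂ (λ S T → Nonempty (S ∩ T)) (cut∘to i) (cut∘to j) ne)
    }
    where
    mincut : Fin (order (X H)) → EdgeSet H
    mincut = lookup (mincuts H)
    mincut-injective : Injective _≡_ _≡_ mincut
    mincut-injective = lookup-injective (Unique.filter⁺ (isMincut? H) (subsets-unique _))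
    classify : ∀ i → ∃[ v ] cut v ≡ mincut i
    classify i = mincut-cut (proj₂ (∈-filter⁻ (isMincut? H) {xs = subsets _} (∈-lookup i)))
    member : ∀ v → cut v ∈ˡ mincuts H
    member v = ∈-filter⁺ (isMincut? H) (∈-subsets (cut v)) (cut-mincut v)
    to : Fin (order (X H)) → Fin (order G)
    to = proj₁ ∘ classify
    from : Fin (order G) → Fin (order (X H))
    from = index ∘ member
    cut∘to : ∀ i → cut (to i) ≡ mincut i
    cut∘to = proj₂ ∘ classify
    mincut∘from : ∀ v → mincut (from v) ≡ cut v
    mincut∘from v = sym (lookup-index (member v))
    to∘from : ∀ v → to (from v) ≡ v
    to∘from v = cut-injective (trans (cut∘to (from v)) (mincut∘from v))
    from∘to : ∀ i → from (to i) ≡ i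
    from∘to i = mincut-injective (trans (mincut∘from (to i)) (cut∘to i))

-- The extension of a graph by a clique

module Extension (G : Graph) (k : ℕ) where

  private
    n = order G

  -- The hub, the n copies and 2 + k further vertices: splitting the clique then costs at least
  -- 2 + (n + k) edges, more than the degree suc n of an original vertex.
  cliqueSize : ℕ
  cliqueSize = 3 + (n + k)

  Node : Set
  Node = Fin n ⊎ Fin cliqueSize

  pattern original v = inj₁ v
  pattern clique c   = inj₂ c

  hub : Fin cliqueSize
  hub = zero

  copy : Fin n → Fin cliqueSize
  copy w = suc (suc (suc (w ↑ˡ k)))

  copy-injective : Injective _≡_ _≡_ copy
  copy-injective = ↑ˡ-injective _ _ _ ∘ suc-injective ∘ suc-injective ∘ suc-injective

  Attached : Fin n → Fin cliqueSize → Set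
  Attached v c = c ≡ hub ⊎ (∃[ w ] c ≡ copy w × ¬ Adj G v w)

  attached? : ∀ v c → Dec (Attached v c)
  attached? v c = (c Fin.≟ hub) ⊎-dec any? λ w → (c Fin.≟ copy w) ×-dec ¬? (adj? G v w)

  infix 4 _~_ _~?_

  _~_ : Node → Node → Set
  original u ~ original v = Adj G u v
  original u ~ clique c   = Attached u c
  clique c   ~ original u = Attached u c
  clique c   ~ clique d   = c ≢ d

  _~?_ : ∀ s t → Dec (s ~ t)
  original u ~? original v = adj? G u v
  original u ~? clique c   = attached? u c
  clique c   ~? original u = attached? u c
  clique c   ~? clique d   = ¬? (c Fin.≟ d)

  ~-sym : ∀ s t → s ~ t → t ~ s
  ~-sym (original u) (original v) = adj-sym G
  ~-sym (original u) (clique c)   = id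
  ~-sym (clique c)   (original u) = id
  ~-sym (clique c)   (clique d)   = ≢-sym

  ~-irrefl : ∀ s → ¬ s ~ s
  ~-irrefl (original u) = loopless G u
  ~-irrefl (clique c)   = λ c≢c → c≢c refl

  node : Fin (n + cliqueSize) → Node
  node = splitAt n

  extension : Graph
  extension = record
    { order    = n + cliqueSize
    ; Adj      = λ x y → node x ~ node y
    ; adj?     = λ x y → node x ~? node y
    ; adj-sym  = λ {x} {y} → ~-sym (node x) (node y)
    ; loopless = λ x → ~-irrefl (node x)
    }

  private
    H = extension

  vertex : Node → Fin (order H)
  vertex = join n cliqueSize

  node∘vertex : ∀ s → node (vertex s) ≡ s
  node∘vertex = splitAt-join n cliqueSize

  vertex∘node : ∀ x → vertex (node x) ≡ x
  vertex∘node = join-splitAt n cliqueSize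

  vertex-injective : Injective _≡_ _≡_ vertex
  vertex-injective eq = trans (sym (node∘vertex _)) (trans (cong node eq) (node∘vertex _))

  ~⇒adj : ∀ {s t} → s ~ t → Adj H (vertex s) (vertex t)
  ~⇒adj {s} {t} = subst₂ _~_ (sym (node∘vertex s)) (sym (node∘vertex t))

  adj⇒~ : ∀ {s t} → Adj H (vertex s) (vertex t) → s ~ t
  adj⇒~ {s} {t} = subst₂ _~_ (node∘vertex s) (node∘vertex t)

  all-vertices : ∀ {P : Fin (order H) → Set} → (∀ s → P (vertex s)) → ∀ x → P x
  all-vertices {P} p x = subst P (vertex∘node x) (p (node x))

  original≢hub : ∀ v → vertex (original v) ≢ vertex (clique hub)
  original≢hub v eq with () ← vertex-injective {original v} {clique hub} eq

  -- Every vertex is the hub or adjacent to it, so any two are joined through the hub.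
  connected : Connected H
  connected x y = to-hub x ◅◅ Star.reverse (adj-sym H) (to-hub y)
    where
    to-hub : ∀ x → Star (Adj H) x (vertex (clique hub))
    to-hub = all-vertices λ where
      (original v)     → ~⇒adj {original v} {clique hub} (inj₁ refl) ◅ ε
      (clique zero)    → ε
      (clique (suc c)) → ~⇒adj {clique (suc c)} {clique hub} (λ ()) ◅ ε

  -- Stars of the original vertices as edge-cuts

  starCut : Fin n → EdgeSet H
  starCut v = star H (vertex (original v))

  starCut-isEdgeCut : ∀ v → IsEdgeCut H (starCut v)
  starCut-isEdgeCut v = connected , star-disconnects H (original≢hub v)

  -- As w varies, rung v w runs through the neighbours of v other than the hub.
  rung : Fin n → Fin n → Node
  rung v w with adj? G v w
  ... | yes _ = original w
  ... | no  _ = clique (copy w)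

  adj⇒rung : ∀ {v w} → Adj G v w → rung v w ≡ original w
  adj⇒rung {v} {w} vw with adj? G v w
  ... | yes _  = refl
  ... | no ¬vw = contradiction vw ¬vw

  ¬adj⇒rung : ∀ {v w} → ¬ Adj G v w → rung v w ≡ clique (copy w)
  ¬adj⇒rung {v} {w} ¬vw with adj? G v w
  ... | yes vw = contradiction vw ¬vw
  ... | no _   = refl

  ~rung : ∀ v w → original v ~ rung v w
  ~rung v w with adj? G v w
  ... | yes vw = vw
  ... | no ¬vw = inj₂ (w , refl , ¬vw)

  neighbour : Fin n → Fin (suc n) → Node
  neighbour v zero    = clique hub
  neighbour v (suc w) = rung v w

  ~neighbour : ∀ v i → original v ~ neighbour v i
  ~neighbour v zero    = inj₁ refl
  ~neighbour v (suc w) = ~rung v w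

  neighbour-covers : ∀ {v} t → original v ~ t → ∃[ i ] neighbour v i ≡ t
  neighbour-covers (original w) vw                        = suc w , adj⇒rung vw
  neighbour-covers (clique c)   (inj₁ refl)               = zero , refl
  neighbour-covers (clique c)   (inj₂ (w , refl , ¬vw))   = suc w , ¬adj⇒rung ¬vw

  -- The edges to the `suc n` values of `neighbour v` exhaust the star. The reverse inequality is an
  -- instance of `cut-size`, since the star is an edge-cut.
  ∣starCut∣≤ : ∀ v → ∣ starCut v ∣ ≤ suc n
  ∣starCut∣≤ v = covered⇒∣p∣≤ (proj₁ ∘ spoke) cover
    where
    spoke : ∀ i → ∃[ e ] Joins H e (vertex (original v)) (vertex (neighbour v i))
    spoke i = edge-joining H (~⇒adj {original v} {neighbour v i} (~neighbour v i))
    cover : ∀ {e} → e ∈ starCut v → ∃[ i ] proj₁ (spoke i) ≡ e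
    cover e∈ with ∈-star⁻ H e∈
    ... | x , j with neighbour-covers (node x)
                       (subst (_~ node x) (node∘vertex (original v)) (joins⇒adj H j))
    ... | i , eq = i , joins-unique H (proj₂ (spoke i))
                         (subst (Joins H _ _) (trans (sym (vertex∘node x)) (cong vertex (sym eq))) j)

  -- The edge from `u` to the hub has `u` as its only original end, so it lies in no other star cut.
  starCut-injective : Injective _≡_ _≡_ starCut
  starCut-injective {u} {v} eq
    with edge-joining H (~⇒adj {original u} {clique hub} (inj₁ refl))
  ... | e , j with ∈-star⁻ H (subst (e ∈_) eq (∈-star⁺ H j))
  ... | x , j′ with joins-ends H j j′
  ... | inj₁ p = inj₁-injective (vertex-injective {original u} {original v} (,-injectiveˡ p))
  ... | inj₂ p = contradiction (sym (,-injectiveʳ p)) (original≢hub v)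

  starCut-meets : ∀ u v → Adj G u v ⇔ (u ≢ v × Nonempty (starCut u ∩ starCut v))
  starCut-meets u v = mk⇔
    (λ uv → (λ { refl → loopless G u uv }) , star-∩⁺ H (~⇒adj {original u} {original v} uv))
    (λ (u≢v , ne) → adj⇒~ {original u} {original v}
      (star-∩⁻ H (u≢v ∘ inj₁-injective ∘ vertex-injective {original u} {original v}) ne))

  -- Both possible values of `rung v w`, the vertex `w` and its copy, carry the tag `w`. A node has
  -- at most one tag, so edges indexed by `w` can be told apart by the nodes where they end.
  data Tagged : Node → Fin n → Set where
    isOriginal : ∀ {w} → Tagged (original w) w
    isCopy     : ∀ {w} → Tagged (clique (copy w)) w

  tag-unique : ∀ {s t v w} → Tagged s v → Tagged t w → s ≡ t → v ≡ w
  tag-unique isOriginal isOriginal eq = inj₁-injective eq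
  tag-unique isCopy     isCopy     eq = copy-injective (inj₂-injective eq)

  tagged≢hub : ∀ {t w} → Tagged t w → t ≢ clique hub
  tagged≢hub isCopy ()

  rung-tagged : ∀ v w → Tagged (rung v w) w
  rung-tagged v w with adj? G v w
  ... | yes _ = isOriginal
  ... | no  _ = isCopy

  -- Lower bounds for edge-cuts of the extension

  module Separation {S : EdgeSet H} (disconnected : ¬ Connected (H ─ S)) where

    private
      colouring = separating-colouring H disconnected

    colour : Node → Bool
    colour = proj₁ colouring ∘ vertex

    hubColour : Bool
    hubColour = colour (clique hub)

    bichromatic : ∀ {x y} → Adj H x y → proj₁ colouring x ≢ proj₁ colouring y →
                  ∃[ e ] e ∈ S × Joins H e x y
    bichromatic = proj₂ (proj₂ colouring)

    crossing⇒≤ : ∀ {m} (pair : Fin m → Node × Node) → Injective _≡_ _≡_ pair →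
      (∀ i → let (s , t) = pair i in s ~ t × colour s ≢ hubColour × colour t ≡ hubColour) →
      m ≤ ∣ S ∣
    crossing⇒≤ pair pair-inj crosses = crossing⇒≤∣S∣ H colouring hubColour
      (λ i → let s , t = pair i in vertex s , vertex t)
      (λ {i} {j} eq → pair-inj (cong₂ _,_
        (vertex-injective {proj₁ (pair i)} {proj₁ (pair j)} (,-injectiveˡ eq))
        (vertex-injective {proj₂ (pair i)} {proj₂ (pair j)} (,-injectiveʳ eq))))
      (λ i → let st , rest = crosses i in ~⇒adj {proj₁ (pair i)} {proj₂ (pair i)} st , rest)

    -- Each clique vertex `d` other than `c` contributes a cut edge: `c – d` if `d` is coloured like
    -- the hub, and `d – hub` otherwise. Pairs of different kinds have different first components,
    -- as `d` is not `c`.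
    split-clique⇒≤ : ∀ c → colour (clique c) ≢ hubColour → 2 + n ≤ ∣ S ∣
    split-clique⇒≤ c c≢hub = ≤-trans (m≤m+n (2 + n) k) (crossing⇒≤ pair inj crosses)
      where
      pair : Fin (2 + (n + k)) → Node × Node
      pair i with colour (clique (punchIn c i)) Bool.≟ hubColour
      ... | yes _ = clique c , clique (punchIn c i)
      ... | no  _ = clique (punchIn c i) , clique hub
      crosses : ∀ i → let (s , t) = pair i in s ~ t × colour s ≢ hubColour × colour t ≡ hubColour
      crosses i with colour (clique (punchIn c i)) Bool.≟ hubColour
      ... | yes d≡hub = ≢-sym (punchInᵢ≢i c i) , c≢hub , d≡hub
      ... | no  d≢hub = (λ eq → d≢hub (cong (colour ∘ inj₂) eq)) , d≢hub , refl
      inj : Injective _≡_ _≡_ pair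
      inj {i} {j} eq with colour (clique (punchIn c i)) Bool.≟ hubColour
                        | colour (clique (punchIn c j)) Bool.≟ hubColour
      ... | yes _ | yes _ = punchIn-injective c i j (inj₂-injective (,-injectiveʳ eq))
      ... | no  _ | no  _ = punchIn-injective c i j (inj₂-injective (,-injectiveˡ eq))
      ... | yes _ | no  _ =
        contradiction (sym (inj₂-injective (,-injectiveˡ eq))) (punchInᵢ≢i c j)
      ... | no  _ | yes _ =
        contradiction (inj₂-injective (,-injectiveˡ eq)) (punchInᵢ≢i c i)

    module WholeClique (whole : ∀ c → colour (clique c) ≡ hubColour) where

      -- Of two vertices with different colours, one is not coloured like the hub; as the clique is
      -- monochromatic, that one is original.
      exceptional : ∃[ v ] colour (original v) ≢ hubColour
      exceptional = let (x , y , x≢y) , _ = proj₂ colouring in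
        search (node x) (node y) λ eq → x≢y (subst₂ (λ x y → proj₁ colouring x ≡ proj₁ colouring y)
          (vertex∘node x) (vertex∘node y) eq)
        where
        search : ∀ s t → colour s ≢ colour t → ∃[ v ] colour (original v) ≢ hubColour
        search (clique c)   (clique d)   c≢d = contradiction (trans (whole c) (sym (whole d))) c≢d
        search (clique c)   (original v) c≢v = v , λ eq → c≢v (trans (whole c) (sym eq))
        search (original v) t            v≢t with colour (original v) Bool.≟ hubColour
        ... | no  v≢hub = v , v≢hub
        search (original v) (clique d)   v≢d | yes v≡hub =
          contradiction (trans v≡hub (sym (whole d))) v≢d
        search (original v) (original w) v≢w | yes v≡hub = w , λ eq → v≢w (trans v≡hub (sym eq))

      module _ {v} (v≢hub : colour (original v) ≢ hubColour) where

        pair : Fin (suc n) → Node × Node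
        pair zero    = original v , clique hub
        pair (suc w) with colour (original w) Bool.≟ hubColour
        ... | yes _ = original v , rung v w
        ... | no  _ = original w , clique (copy w)

        pair-tagged : ∀ w → Tagged (proj₂ (pair (suc w))) w
        pair-tagged w with colour (original w) Bool.≟ hubColour
        ... | yes _ = rung-tagged v w
        ... | no  _ = isCopy

        pair-crosses : ∀ i → let (s , t) = pair i in
                       s ~ t × colour s ≢ hubColour × colour t ≡ hubColour
        pair-crosses zero    = inj₁ refl , v≢hub , refl
        pair-crosses (suc w) with colour (original w) Bool.≟ hubColour
        -- Looplessness attaches `w` to its own copy.
        ... | no  w≢hub = inj₂ (w , refl , loopless G w) , w≢hub , whole (copy w)
        ... | yes w≡hub = ~rung v w , v≢hub , rung-colour (rung-tagged v w)
          where
          rung-colour : ∀ {t} → Tagged t w → colour t ≡ hubColour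
          rung-colour isOriginal = w≡hub
          rung-colour isCopy     = whole (copy w)

        -- The second components already differ: they are the hub and, for each `w`, a node tagged
        -- `w`.
        pair-injective : Injective _≡_ _≡_ pair
        pair-injective {zero}  {zero}  _  = refl
        pair-injective {zero}  {suc w} eq =
          contradiction (sym (cong proj₂ eq)) (tagged≢hub (pair-tagged w))
        pair-injective {suc w} {zero}  eq =
          contradiction (cong proj₂ eq) (tagged≢hub (pair-tagged w))
        pair-injective {suc w} {suc x} eq =
          cong suc (tag-unique (pair-tagged w) (pair-tagged x) (cong proj₂ eq))

        exceptional⇒≤ : suc n ≤ ∣ S ∣
        exceptional⇒≤ = crossing⇒≤ pair pair-injective pair-crosses

        -- Among the edges of `pair` only `v – hub` ends at the hub, so `v′ – hub` is one more.
        exceptional₂⇒≤ : ∀ {v′} → colour (original v′) ≢ hubColour → v ≢ v′ → 2 + n ≤ ∣ S ∣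
        exceptional₂⇒≤ {v′} v′≢hub v≢v′ = crossing⇒≤ pair′ inj crosses
          where
          pair′ : Fin (2 + n) → Node × Node
          pair′ zero    = original v′ , clique hub
          pair′ (suc i) = pair i
          crosses : ∀ i → let (s , t) = pair′ i in
                    s ~ t × colour s ≢ hubColour × colour t ≡ hubColour
          crosses zero    = inj₁ refl , v′≢hub , refl
          crosses (suc i) = pair-crosses i
          fresh : ∀ i → pair i ≢ (original v′ , clique hub)
          fresh zero    eq = v≢v′ (inj₁-injective (,-injectiveˡ eq))
          fresh (suc w) eq = tagged≢hub (pair-tagged w) (cong proj₂ eq)
          inj : Injective _≡_ _≡_ pair′
          inj {zero}  {zero}  _  = refl
          inj {zero}  {suc j} eq = contradiction (sym eq) (fresh j)
          inj {suc i} {zero}  eq = contradiction eq (fresh i)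
          inj {suc i} {suc j} eq = cong suc (pair-injective eq)

        -- A neighbour of `v` not coloured like the hub would be a second exceptional vertex and
        -- make `S` too large. Hence every edge at `v` is bichromatic.
        starCut⊆ : ∣ S ∣ ≤ suc n → starCut v ⊆ S
        starCut⊆ S≤ {e} e∈ with ∈-star⁻ H e∈
        ... | x , j = in-cut (node x) (subst (Joins H e _) (sym (vertex∘node x)) j)
          where
          in-cut : ∀ t → Joins H e (vertex (original v)) (vertex t) → e ∈ S
          in-cut t j = let f , f∈S , j′ = bichromatic vt v≢t in
            subst (_∈ S) (joins-unique H j′ j) f∈S
            where
            vt : Adj H (vertex (original v)) (vertex t)
            vt = joins⇒adj H j
            t≡hub : ∀ t → original v ~ t → colour t ≡ hubColour
            t≡hub (clique c)   _  = whole c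
            t≡hub (original w) vw = decidable-stable (colour (original w) Bool.≟ hubColour) λ w≢hub →
              <⇒≱ (exceptional₂⇒≤ w≢hub λ { refl → loopless G v vw }) S≤
            v≢t : colour (original v) ≢ colour t
            v≢t eq = v≢hub (trans eq (t≡hub t (adj⇒~ {original v} {t} vt)))

    clique-split? : (∃[ c ] colour (clique c) ≢ hubColour) ⊎ (∀ c → colour (clique c) ≡ hubColour)
    clique-split? with any? (λ c → ¬? (colour (clique c) Bool.≟ hubColour))
    ... | yes split = inj₁ split
    ... | no ∄split = inj₂ λ c → decidable-stable (colour (clique c) Bool.≟ hubColour) λ c≢hub →
      ∄split (c , c≢hub)

    cut-size : suc n ≤ ∣ S ∣
    cut-size with clique-split?
    ... | inj₁ (c , c≢hub) = ≤-trans (n≤1+n (suc n)) (split-clique⇒≤ c c≢hub)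
    ... | inj₂ whole       = let open WholeClique whole in exceptional⇒≤ (proj₂ exceptional)

    small⇒star : ∣ S ∣ ≤ suc n → ∃[ v ] starCut v ⊆ S
    small⇒star S≤ with clique-split?
    ... | inj₁ (c , c≢hub) = contradiction S≤ (<⇒≱ (split-clique⇒≤ c c≢hub))
    ... | inj₂ whole       = let open WholeClique whole ; v , v≢hub = exceptional in
      v , starCut⊆ v≢hub S≤

  -- The mincuts of the extension

  starCut-isMincut : ∀ v → IsMincut H (starCut v)
  starCut-isMincut v = starCut-isEdgeCut v , λ T (_ , disconnected) →
    ≤-trans (∣starCut∣≤ v) (Separation.cut-size disconnected)

  -- The star of `v₀` bounds the size of `S` by `suc n`, so `S` contains some star. That star is an
  -- edge-cut, hence no smaller than `S`, and the inclusion is an equality.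
  mincut-isStarCut : Fin n → ∀ {S} → IsMincut H S → ∃[ v ] starCut v ≡ S
  mincut-isStarCut v₀ {S} ((_ , disconnected) , minimal) =
    let v , star⊆S = Separation.small⇒star disconnected
          (≤-trans (minimal (starCut v₀) (starCut-isEdgeCut v₀)) (∣starCut∣≤ v₀))
    in v , ⊆∧∣∣≤⇒≡ {p = starCut v} {S} star⊆S (minimal (starCut v) (starCut-isEdgeCut v))

  X-extension : Fin n → X extension ≅ G
  X-extension v₀ = mincuts-classified⇒X≅ H G starCut starCut-injective starCut-isMincut
    (mincut-isStarCut v₀) starCut-meets

-- The graph without vertices, and the infinite families

edgeless : ℕ → Graph
edgeless k = record
  { order    = k
  ; Adj      = λ _ _ → ⊥
  ; adj?     = λ _ _ → no id
  ; adj-sym  = id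
  ; loopless = λ _ → id
  }

-- Deleting edges from an edgeless graph changes nothing, so there is no edge-cut and both sides are
-- null graphs.
X-edgeless : ∀ k {G} → ¬ Fin (order G) → X (edgeless k) ≅ G
X-edgeless k {G} empty = mincuts-classified⇒X≅ (edgeless k) G
  (⊥-elim ∘ empty) (λ {v} → ⊥-elim (empty v)) (⊥-elim ∘ empty)
  (λ ((connected , disconnected) , _) →
    contradiction (λ u v → Star.map (λ ()) (connected u v)) disconnected)
  (⊥-elim ∘ empty)

inhabited? : ∀ n → Dec (Fin n)
inhabited? zero    = no λ ()
inhabited? (suc n) = yes zero

≅⇒order≡ : ∀ {G H} → G ≅ H → order G ≡ order H
≅⇒order≡ iso = ↔⇒≡ (_≅_.bijection iso)

theorem4p7 : (G : Graph) → Σ[ G* ∈ (ℕ → Graph) ] ((∀ i → X (G* i) ≅ G) × (∀ i j → i ≢ j → ¬ (G* i ≅ G* j)))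
theorem4p7 G with inhabited? (order G)
-- Here the extension would be a bare clique, whose mincut graph is not null.
... | no empty = edgeless , (λ k → X-edgeless k empty) , λ i j i≢j → i≢j ∘ ≅⇒order≡
... | yes v₀   = Extension.extension G , (λ k → Extension.X-extension G k v₀) , λ i j i≢j iso →
  -- The extension with parameter `k` has order `n + (3 + (n + k))`, which determines `k`.
  i≢j (ℕ.+-cancelˡ-≡ n i j (ℕ.+-cancelˡ-≡ 3 _ _ (ℕ.+-cancelˡ-≡ n _ _ (≅⇒order≡ iso))))
  where n = order G
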